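{- If $\{A_1,\dots,A_n\}\vdash B$ is not derivable in $\mathbf{LA}\mu$, then there exist an $\mathbf{LA}$-frame $(\mathcal W_0,\rhd_0,R_0)$, a hereditary valuation $\xi_0$ and $p_0\in\mathcal W_0$ such that $\models^{\xi_0}_{p_0}A_i$ for every $i\in\{1,\dots,n\}$ but not $\models^{\xi_0}_{p_0}B$.
   Context: Formulae are type expressions: pseudo type expressions $A::=X\mid A\to B\mid\bullet A\mid\mu X.A$ ($\alpha$-equivalent ones identified; $A[B/X]$ capture-avoiding substitution) in which every subexpression $\mu X.A$ has $A$ proper in $X$. Tail: $t(X)=X$, $t(A\to B)=t(B)$, $t(\bullet A)=\bullet t(A)$, $t(\mu X.A)=\mu X.t(A)$; $A$ is a $\top$-variant iff $t(A)=\bullet^{m_0}\mu X_1.\bullet^{m_1}\cdots\mu X_n.\bullet^{m_n}X_i$ with $1\le i\le n$, $X_i\notin\{X_{i+1},\dots,X_n\}$, $m_i+\dots+m_n\ge1$; properness in $X$: variable $Y$ iff $Y\ne X$; $\bullet A$ always; $A\to B$ iff both are or $B$ is a $\top$-variant; $\mu Y.A$ ($Y\ne X$) iff $A$ is or $\mu Y.A$ is a $\top$-variant. $\mathbf{LA}\mu$ derives $\Gamma\vdash A$ ($\Gamma$ finite set of formulae, $\bullet\Gamma=\{\bullet C\mid C\in\Gamma\}$) by: $\Gamma\cup\{A\}\vdash A$; from $\Gamma_1\vdash A$ infer $\bullet\Gamma_1\cup\Gamma_2\vdash\bullet A$; from $\Gamma\vdash\bullet A$ infer $\Gamma\vdash\bullet\bullet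 A$; from $\Gamma\cup\{A\}\vdash B$ infer $\Gamma\vdash A\to B$; from $\Gamma_1\vdash A\to B$ and $\Gamma_2\vdash A$ infer $\Gamma_1\cup\Gamma_2\vdash B$; from $\Gamma\vdash A[\mu X.A/X]$ infer $\Gamma\vdash\mu X.A$ and conversely; from $\Gamma\vdash\bullet A\to\bullet B$ infer $\Gamma\vdash\bullet(A\to B)$; from $\Gamma\vdash A$ infer $\Gamma\vdash\bullet A$. $\mathbf{LA}$-frames: triples $(\mathcal W,\rhd,R)$ with $\mathcal W$ nonempty; no infinite chain $p_0\rhd p_1\rhd\cdots$; $R$ reflexive and transitive; $pRq\rhd r\Rightarrow p\rhd r$; $p\rhd q\Rightarrow pRq$; if $p\rhd qRq'$ then there is $r$ with $pRr\rhd q'$ and $r\rhd s\Rightarrow q'Rs$ for all $s$. A valuation $\xi$ maps each variable to a function $\mathcal W\to\{\mathbf t,\mathbf f\}$; hereditary iff $pRq$ and $\xi(X)(p)=\mathbf t$ imply $\xi(X)(q)=\mathbf t$. Forcing: $\models^\xi_pA$ if $A$ is a $\top$-variant; otherwise $\models^\xi_pX$ iff $\xi(X)(p)=\mathbf t$; $\models^\xi_p\bullet A$ iff $\models^\xi_qA$ for all $q$ with $p\rhd q$; $\models^\xi_pA\to B$ iff for all $q$ with $pRq$, $\models^\xi_qA$ implies $\models^\xi_qB$; $\models^\xi_p\mu X.A$ iff $\models^\xi_pA[\mu X.A/X]$. -}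

module Defs where

open import Data.Nat using (ℕ; zero; suc)
open import Data.Bool using (Bool; true; false; T)
open import Data.List using (List; []; _∷_; _++_; map)
open import Data.List.Relation.Unary.All using (All)
open import Data.List.Membership.Propositional using (_∈_)
open import Data.Product using (Σ; _×_; _,_)
open import Data.Sum using (_⊎_)
open import Data.Unit using (⊤)
open import Data.Empty using (⊥)
open import Relation.Nullary using (¬_)
open import Relation.Binary.PropositionalEquality using (_≡_; _≢_)

-- Pseudo type expressions, with de Bruijn indices (so α-equivalent
-- expressions are identified).  `var k` is the k-th enclosing binder
-- if k is smaller than the number of enclosing μ's, otherwise it is a
-- free variable (free variables are named by natural numbers).

infixr 30 _⇒_
data PType : Set where
  var : ℕ → PType
  _⇒_ : PType → PType → PType
  •_  : PType → PType
  μ_  : PType → PType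

ext : (ℕ → ℕ) → ℕ → ℕ
ext ρ zero    = zero
ext ρ (suc k) = suc (ρ k)

ren : (ℕ → ℕ) → PType → PType
ren ρ (var k) = var (ρ k)
ren ρ (A ⇒ B) = ren ρ A ⇒ ren ρ B
ren ρ (• A)   = • ren ρ A
ren ρ (μ A)   = μ ren (ext ρ) A

exts : (ℕ → PType) → ℕ → PType
exts σ zero    = var zero
exts σ (suc k) = ren suc (σ k)

sub : (ℕ → PType) → PType → PType
sub σ (var k) = σ k
sub σ (A ⇒ B) = sub σ A ⇒ sub σ B
sub σ (• A)   = • sub σ A
sub σ (μ A)   = μ sub (exts σ) A

single : PType → ℕ → PType
single u zero    = u
single u (suc k) = var k

_[_/0] : PType → PType → PType
A [ u /0] = sub (single u) A

unfold : PType → PType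
unfold A = A [ μ A /0]

tail : PType → PType
tail (var k) = var k
tail (A ⇒ B) = tail B
tail (• A)   = • tail A
tail (μ A)   = μ tail A

lkp : List Bool → ℕ → Bool
lkp []       k       = false
lkp (b ∷ bs) zero    = b
lkp (b ∷ bs) (suc k) = lkp bs k

-- tv bs C checks that C has the shape •^{m_0} μX_1.•^{m_1} ⋯ μX_n.•^{m_n} X_i
-- with X_i bound by one of the displayed μ's (the de Bruijn index refers to
-- binder i, so X_i ∉ {X_{i+1},…,X_n}) and with at least one • between
-- μX_i and the variable.  bs records, for each enclosing binder
-- (innermost first), whether a • has occurred since that binder.
tv : List Bool → PType → Bool
tv bs (var k) = lkp bs k
tv bs (A ⇒ B) = false
tv bs (• A)   = tv (map (λ _ → true) bs) A
tv bs (μ A)   = tv (false ∷ bs) A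

TopVariant : PType → Set
TopVariant A = T (tv [] (tail A))

Proper : ℕ → PType → Set
Proper x (var y) = y ≢ x
Proper x (• A)   = ⊤
Proper x (A ⇒ B) = (Proper x A × Proper x B) ⊎ TopVariant B
Proper x (μ A)   = Proper (suc x) A ⊎ TopVariant (μ A)

IsFormula : PType → Set
IsFormula (var k) = ⊤
IsFormula (A ⇒ B) = IsFormula A × IsFormula B
IsFormula (• A)   = IsFormula A
IsFormula (μ A)   = Proper zero A × IsFormula A

-- The sequent calculus LAμ.  Finite sets of formulae are lists, and all
-- context operations are expressed through membership / set equality,
-- so derivability only depends on the set of formulae in a context.
-- Every judgement occurring in a derivation consists of formulae.

Ctx : Set
Ctx = List PType

_≈ₛ_ : Ctx → Ctx → Set
Γ ≈ₛ Δ = (∀ {C} → C ∈ Γ → C ∈ Δ) × (∀ {C} → C ∈ Δ → C ∈ Γ)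

WFJ : Ctx → PType → Set
WFJ Γ A = All IsFormula Γ × IsFormula A

infix 4 _⊢_
data _⊢_ : Ctx → PType → Set where
  ax   : ∀ {Γ A} → WFJ Γ A → A ∈ Γ → Γ ⊢ A
  •I   : ∀ {Γ Γ₁ A} → WFJ Γ (• A) → Γ₁ ⊢ A →
         (∀ {C} → C ∈ Γ₁ → (• C) ∈ Γ) → Γ ⊢ • A
  ••I  : ∀ {Γ A} → WFJ Γ (• • A) → Γ ⊢ • A → Γ ⊢ • • A
  ⇒I   : ∀ {Γ Γ' A B} → WFJ Γ (A ⇒ B) → Γ' ⊢ B → Γ' ≈ₛ (A ∷ Γ) → Γ ⊢ A ⇒ B
  ⇒E   : ∀ {Γ Γ₁ Γ₂ A B} → WFJ Γ B → Γ₁ ⊢ A ⇒ B → Γ₂ ⊢ A →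
         Γ ≈ₛ (Γ₁ ++ Γ₂) → Γ ⊢ B
  μI   : ∀ {Γ A} → WFJ Γ (μ A) → Γ ⊢ unfold A → Γ ⊢ μ A
  μE   : ∀ {Γ A} → WFJ Γ (unfold A) → Γ ⊢ μ A → Γ ⊢ unfold A
  •⇒   : ∀ {Γ A B} → WFJ Γ (• (A ⇒ B)) → Γ ⊢ (• A) ⇒ (• B) → Γ ⊢ • (A ⇒ B)
  nec  : ∀ {Γ A} → WFJ Γ (• A) → Γ ⊢ A → Γ ⊢ • A

record LAFrame : Set₁ where
  field
    W        : Set
    _▷_      : W → W → Set
    R        : W → W → Set
    nonempty : W
    noChain  : ¬ (Σ (ℕ → W) λ f → ∀ n → f n ▷ f (suc n))
    R-refl   : ∀ p → R p p
    R-trans  : ∀ {p q r} → R p q → R q r → R p r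
    R▷⇒▷     : ∀ {p q r} → R p q → q ▷ r → p ▷ r
    ▷⇒R      : ∀ {p q} → p ▷ q → R p q
    ▷R       : ∀ {p q q'} → p ▷ q → R q q' →
               Σ W λ r → R p r × r ▷ q' × (∀ s → r ▷ s → R q' s)

open LAFrame public

Valuation : LAFrame → Set
Valuation 𝓕 = ℕ → W 𝓕 → Bool

Hereditary : (𝓕 : LAFrame) → Valuation 𝓕 → Set
Hereditary 𝓕 ξ = ∀ x p q → R 𝓕 p q → ξ x p ≡ true → ξ x q ≡ true

-- Forcing.  The paper defines ⊨ by the clauses below; we express this
-- as the property of a relation `Fo` (Fo p A meaning ⊨^ξ_p A) of
-- satisfying these clauses on all formulae.

Clause : (𝓕 : LAFrame) → Valuation 𝓕 → (W 𝓕 → PType → Set) → W 𝓕 → PType → Set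
Clause 𝓕 ξ Fo p (var x) = ξ x p ≡ true
Clause 𝓕 ξ Fo p (• A)   = ∀ q → _▷_ 𝓕 p q → Fo q A
Clause 𝓕 ξ Fo p (A ⇒ B) = ∀ q → R 𝓕 p q → Fo q A → Fo q B
Clause 𝓕 ξ Fo p (μ A)   = Fo p (unfold A)

IsForcing : (𝓕 : LAFrame) → Valuation 𝓕 → (W 𝓕 → PType → Set) → Set
IsForcing 𝓕 ξ Fo = ∀ p A → IsFormula A →
  (TopVariant A → Fo p A) ×
  (¬ TopVariant A → (Fo p A → Clause 𝓕 ξ Fo p A) × (Clause 𝓕 ξ Fo p A → Fo p A))

module Submission where

-- LA-frames of the form V × {0,…,N}, in which ▷ lowers the second component (the level)
-- while R may extend the first, suffice: at level i, • refers to level i-1 and is void at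
-- level 0, so LAμ over formulae A@i becomes an ordinary intuitionistic calculus, analytic
-- over the finite set Cl × {0,…,N} with Cl the closure of the given formulae under parts
-- and unfolding. That calculus is decidable, and its contexts ordered by inclusion form
-- the required canonical countermodel.
--
-- What is left is that As@N ⊩ B@N implies As ⊢ B when N is the size of Cl. Here A@i is
-- read as "A belongs to every theory reached by N-i descents from a given theory", where
-- q is a descent from p if •A ∈ p implies A ∈ q. If •A ∉ p, then by Löb's principle
-- the descent of p generated by •A omits A; it contains one more formula •A of Cl, so N
-- descents always suffice. The rule for → rests on •A → •B ⊢ •(A → B): an extension of
-- the last theory of a descent is reached from an extension of the first one.

open import Defs
open import Data.Bool using (Bool; true; false; T; if_then_else_)
open import Data.Bool.Properties using (T?)
open import Data.Empty using (⊥; ⊥-elim)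
open import Data.Unit using (⊤; tt)
open import Data.Nat using (ℕ; zero; suc; pred; _+_; _≤_; _<_; _⊔_; z≤n; s≤s; z<s; s<s; s≤s⁻¹)
import Data.Nat.Properties as ℕₚ
open import Data.List using (List; []; _∷_; _++_; map; length; cartesianProduct; upTo)
open import Data.List.Properties using (length-map)
open import Data.List.Relation.Unary.All as All using (All; []; _∷_)
import Data.List.Relation.Unary.All.Properties as Allₚ
open import Data.List.Relation.Unary.Any using (Any; here; there; any?)
open import Data.List.Membership.Propositional using (_∈_; find; lose)
open import Data.List.Membership.Propositional.Properties using (∈-++⁺ˡ; ∈-++⁺ʳ; ∈-++⁻; ∈-map⁺; ∈-map⁻; ∈-cartesianProduct⁺; ∈-cartesianProduct⁻; ∈-upTo⁺; ∈-upTo⁻)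
import Data.List.Membership.DecPropositional as DecMembership
open import Data.List.Relation.Binary.Subset.Propositional using (_⊆_)
open import Data.Product using (Σ; _×_; _,_; proj₁; proj₂; ∃)
open import Data.Product.Properties using (≡-dec)
open import Data.Sum using (_⊎_; inj₁; inj₂; [_,_]′) renaming (map₂ to map₂⊎)
open import Function using (_∘_; id)
open import Relation.Nullary using (¬_; Dec; yes; no; does; contradiction)
open import Relation.Nullary.Decidable using (map′; dec-true; ¬?; _×-dec_; _⊎-dec_)
open import Relation.Binary using (DecidableEquality)
open import Relation.Binary.PropositionalEquality
  using (_≡_; _≢_; refl; sym; trans; cong; cong₂; subst)

-- Renaming and substitution

sub-id : ∀ {σ} → (∀ x → σ x ≡ var x) → ∀ A → sub σ A ≡ A
sub-id h (var x) = h x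
sub-id h (A ⇒ B) = cong₂ _⇒_ (sub-id h A) (sub-id h B)
sub-id h (• A)   = cong •_ (sub-id h A)
sub-id h (μ A)   = cong μ_ (sub-id (λ { zero → refl ; (suc x) → cong (ren suc) (h x) }) A)

ren-ren : ∀ {ρ ρ′ ρ″} → (∀ x → ρ′ (ρ x) ≡ ρ″ x) → ∀ A → ren ρ′ (ren ρ A) ≡ ren ρ″ A
ren-ren h (var x) = cong var (h x)
ren-ren h (A ⇒ B) = cong₂ _⇒_ (ren-ren h A) (ren-ren h B)
ren-ren h (• A)   = cong •_ (ren-ren h A)
ren-ren h (μ A)   = cong μ_ (ren-ren (λ { zero → refl ; (suc x) → cong suc (h x) }) A)

sub-ren : ∀ {ρ σ τ} → (∀ x → σ (ρ x) ≡ τ x) → ∀ A → sub σ (ren ρ A) ≡ sub τ A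
sub-ren h (var x) = h x
sub-ren h (A ⇒ B) = cong₂ _⇒_ (sub-ren h A) (sub-ren h B)
sub-ren h (• A)   = cong •_ (sub-ren h A)
sub-ren h (μ A)   = cong μ_ (sub-ren (λ { zero → refl ; (suc x) → cong (ren suc) (h x) }) A)

ren-sub : ∀ {ρ σ τ} → (∀ x → ren ρ (σ x) ≡ τ x) → ∀ A → ren ρ (sub σ A) ≡ sub τ A
ren-sub h (var x) = h x
ren-sub h (A ⇒ B) = cong₂ _⇒_ (ren-sub h A) (ren-sub h B)
ren-sub h (• A)   = cong •_ (ren-sub h A)
ren-sub {ρ} {σ} {τ} h (μ A) = cong μ_ (ren-sub exts-h A)
  where
  exts-h : ∀ x → ren (ext ρ) (exts σ x) ≡ exts τ x
  exts-h zero    = refl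
  exts-h (suc x) = trans (ren-ren (λ _ → refl) (σ x))
    (trans (sym (ren-ren (λ _ → refl) (σ x))) (cong (ren suc) (h x)))

sub-sub : ∀ {σ τ υ} → (∀ x → sub τ (σ x) ≡ υ x) → ∀ A → sub τ (sub σ A) ≡ sub υ A
sub-sub h (var x) = h x
sub-sub h (A ⇒ B) = cong₂ _⇒_ (sub-sub h A) (sub-sub h B)
sub-sub h (• A)   = cong •_ (sub-sub h A)
sub-sub {σ} {τ} {υ} h (μ A) = cong μ_ (sub-sub exts-h A)
  where
  exts-h : ∀ x → sub (exts τ) (exts σ x) ≡ exts υ x
  exts-h zero    = refl
  exts-h (suc x) = trans (sub-ren (λ _ → refl) (σ x))
    (trans (sym (ren-sub (λ _ → refl) (σ x))) (cong (ren suc) (h x)))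

infixr 20 _◂_
_◂_ : PType → (ℕ → PType) → ℕ → PType
(u ◂ σ) zero    = u
(u ◂ σ) (suc x) = σ x

-- For `u = sub σ (μ A)` the left side is the unfolding of `u`, so unfolding an instance of a μ
-- amounts to extending the substitution.
single-exts : ∀ u σ A → sub (single u) (sub (exts σ) A) ≡ sub (u ◂ σ) A
single-exts u σ = sub-sub λ
  { zero    → refl
  ; (suc x) → trans (sub-ren (λ _ → refl) (σ x)) (sub-id (λ _ → refl) (σ x)) }

single-ren : ∀ u A → ren suc A [ u /0] ≡ A
single-ren u A = trans (sub-ren (λ _ → refl) A) (sub-id (λ _ → refl) A)

-- ⊤-variants, properness and formulae under substitution

-- The final variable of a ⊤-variant is bound inside it, so a substitution that fixes the binders
-- recorded in `bs` leaves the shape intact.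
tv-sub : ∀ bs {σ} → (∀ i → i < length bs → σ i ≡ var i) → ∀ A →
  T (tv bs (tail A)) → T (tv bs (tail (sub σ A)))
tv-sub bs h (var x) t with i<len bs x t
  where
  i<len : ∀ bs x → T (lkp bs x) → x < length bs
  i<len (b ∷ bs) zero    t = z<s
  i<len (b ∷ bs) (suc x) t = s<s (i<len bs x t)
... | x<len rewrite h x x<len = t
tv-sub bs h (A ⇒ B) t = tv-sub bs h B t
tv-sub bs h (• A)   t =
  tv-sub (map (λ _ → true) bs) (λ i i< → h i (subst (i <_) (length-map _ bs) i<)) A t
tv-sub bs h (μ A)   t = tv-sub (false ∷ bs)
  (λ { zero _ → refl ; (suc i) (s≤s i<) → cong (ren suc) (h i i<) }) A t

TopVariant-sub : ∀ {σ} A → TopVariant A → TopVariant (sub σ A)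
TopVariant-sub = tv-sub [] (λ _ ())

ren-as-sub : ∀ {ρ σ} → (∀ x → var (ρ x) ≡ σ x) → ∀ A → ren ρ A ≡ sub σ A
ren-as-sub h (var x) = h x
ren-as-sub h (A ⇒ B) = cong₂ _⇒_ (ren-as-sub h A) (ren-as-sub h B)
ren-as-sub h (• A)   = cong •_ (ren-as-sub h A)
ren-as-sub h (μ A)   = cong μ_ (ren-as-sub (λ { zero → refl ; (suc x) → cong (ren suc) (h x) }) A)

TopVariant-ren : ∀ {ρ} A → TopVariant A → TopVariant (ren ρ A)
TopVariant-ren A t = subst TopVariant (sym (ren-as-sub (λ _ → refl) A)) (TopVariant-sub A t)

Proper-ren : ∀ {ρ x z} → (∀ y → ρ y ≡ z → y ≡ x) → ∀ A → Proper x A → Proper z (ren ρ A)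
Proper-ren h (var y) y≢x = y≢x ∘ h y
Proper-ren h (A ⇒ B) (inj₁ (p , q)) = inj₁ (Proper-ren h A p , Proper-ren h B q)
Proper-ren h (A ⇒ B) (inj₂ t)       = inj₂ (TopVariant-ren B t)
Proper-ren h (• A)   _        = tt
Proper-ren h (μ A)   (inj₁ p) = inj₁ (Proper-ren
  (λ { zero () ; (suc y) e → cong suc (h y (ℕₚ.suc-injective e)) }) A p)
Proper-ren h (μ A)   (inj₂ t) = inj₂ (TopVariant-ren (μ A) t)

Proper-fresh : ∀ {ρ z} → (∀ y → ρ y ≢ z) → ∀ A → Proper z (ren ρ A)
Proper-fresh h (var y) = h y
Proper-fresh h (A ⇒ B) = inj₁ (Proper-fresh h A , Proper-fresh h B)
Proper-fresh h (• A)   = tt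
Proper-fresh h (μ A)   = inj₁ (Proper-fresh
  (λ { zero () ; (suc y) e → h y (ℕₚ.suc-injective e) }) A)

Proper-sub : ∀ {σ x z} → (∀ y → y ≢ x → Proper z (σ y)) → ∀ A → Proper x A → Proper z (sub σ A)
Proper-sub h (var y) y≢x = h y y≢x
Proper-sub h (A ⇒ B) (inj₁ (p , q)) = inj₁ (Proper-sub h A p , Proper-sub h B q)
Proper-sub h (A ⇒ B) (inj₂ t)       = inj₂ (TopVariant-sub B t)
Proper-sub h (• A)   _        = tt
Proper-sub {σ} h (μ A) (inj₁ p) = inj₁ (Proper-sub
  (λ { zero _ () ; (suc y) y≢ → Proper-ren (λ _ → ℕₚ.suc-injective) (σ y) (h y (y≢ ∘ cong suc)) }) A p)
Proper-sub h (μ A)   (inj₂ t) = inj₂ (TopVariant-sub (μ A) t)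

IsFormula-ren : ∀ {ρ} A → IsFormula A → IsFormula (ren ρ A)
IsFormula-ren (var x) _       = tt
IsFormula-ren (A ⇒ B) (f , g) = IsFormula-ren A f , IsFormula-ren B g
IsFormula-ren (• A)   f       = IsFormula-ren A f
IsFormula-ren (μ A)   (p , f) =
  Proper-ren (λ { zero _ → refl ; (suc y) () }) A p , IsFormula-ren A f

IsFormula-sub : ∀ {σ} → (∀ x → IsFormula (σ x)) → ∀ A → IsFormula A → IsFormula (sub σ A)
IsFormula-sub h (var x) _       = h x
IsFormula-sub h (A ⇒ B) (f , g) = IsFormula-sub h A f , IsFormula-sub h B g
IsFormula-sub h (• A)   f       = IsFormula-sub h A f
IsFormula-sub {σ} h (μ A) (p , f) =
  Proper-sub (λ { zero y≢ → contradiction refl y≢ ; (suc y) _ → Proper-fresh (λ _ ()) (σ y) }) A p ,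
  IsFormula-sub (λ { zero → tt ; (suc x) → IsFormula-ren (σ x) (h x) }) A f

IsFormula-unfold : ∀ A → IsFormula (μ A) → IsFormula (unfold A)
IsFormula-unfold A f = IsFormula-sub (λ { zero → f ; (suc _) → tt }) A (proj₂ f)

-- Rank of a formula

TopVariant? : ∀ A → Dec (TopVariant A)
TopVariant? A = T? (tv [] (tail A))

-- Bullets and ⊤-variants are leaves because forcing descends along ▷ at the former
-- and stops at the latter.
rank : PType → ℕ
rank (var x) = 0
rank (A ⇒ B) = if tv [] (tail B) then 0 else suc (rank A ⊔ rank B)
rank (• A)   = 0
rank (μ A)   = if tv [] (tail (μ A)) then 0 else suc (rank A)

rank-⇒ : ∀ A B → ¬ TopVariant (A ⇒ B) → rank (A ⇒ B) ≡ suc (rank A ⊔ rank B)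
rank-⇒ A B ¬t with tv [] (tail B)
... | true  = contradiction tt ¬t
... | false = refl

rank-μ : ∀ A → ¬ TopVariant (μ A) → rank (μ A) ≡ suc (rank A)
rank-μ A ¬t with tv [] (tail (μ A))
... | true  = contradiction tt ¬t
... | false = refl

rank-TopVariant : ∀ A → TopVariant A → rank A ≡ 0
rank-TopVariant (A ⇒ B) t with tv [] (tail B)
... | true = refl
rank-TopVariant (• A) t = refl
rank-TopVariant (μ A) t with tv [] (tail (μ A))
... | true = refl

rank-⇒≤ : ∀ A B → rank (A ⇒ B) ≤ suc (rank A ⊔ rank B)
rank-⇒≤ A B with tv [] (tail B)
... | true  = z≤n
... | false = ℕₚ.≤-refl

rank-μ≤ : ∀ A → rank (μ A) ≤ suc (rank A)
rank-μ≤ A with tv [] (tail (μ A))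
... | true  = z≤n
... | false = ℕₚ.≤-refl

-- A variable proper in `A` occurs only below a bullet or inside a ⊤-variant, both leaves for
-- `rank`, so its substitute does not count; any other variable is merely renamed.
rank-sub : ∀ {σ} A → (∀ x → Proper x A ⊎ ∃ λ y → σ x ≡ var y) → rank (sub σ A) ≤ rank A
rank-sub (var x) h with h x
... | inj₁ p       = contradiction refl p
... | inj₂ (y , e) rewrite e = z≤n
rank-sub (• A) h = z≤n
rank-sub {σ} (A ⇒ B) h with TopVariant? B
... | yes t rewrite rank-TopVariant (sub σ A ⇒ sub σ B) (TopVariant-sub B t) = z≤n
... | no ¬t rewrite rank-⇒ A B ¬t = ℕₚ.≤-trans (rank-⇒≤ (sub σ A) (sub σ B))
  (s≤s (ℕₚ.⊔-mono-≤ (rank-sub A (split proj₁)) (rank-sub B (split proj₂))))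
  where
  split : ∀ {P : ℕ → Set} → (∀ {x} → Proper x A × Proper x B → P x) →
    ∀ x → P x ⊎ ∃ λ y → σ x ≡ var y
  split f x with h x
  ... | inj₁ (inj₁ p) = inj₁ (f p)
  ... | inj₁ (inj₂ t) = contradiction t ¬t
  ... | inj₂ v        = inj₂ v
rank-sub {σ} (μ A) h with TopVariant? (μ A)
... | yes t rewrite rank-TopVariant (μ sub (exts σ) A) (TopVariant-sub (μ A) t) = z≤n
... | no ¬t rewrite rank-μ A ¬t = ℕₚ.≤-trans (rank-μ≤ (sub (exts σ) A)) (s≤s (rank-sub A under))
  where
  under : ∀ x → Proper x A ⊎ ∃ λ y → exts σ x ≡ var y
  under zero = inj₂ (zero , refl)
  under (suc x) with h x
  ... | inj₁ (inj₁ p) = inj₁ p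
  ... | inj₁ (inj₂ t) = contradiction t ¬t
  ... | inj₂ (y , e)  = inj₂ (suc y , cong (ren suc) e)

-- Makes the forcing clause for μ well founded, since `rank (μ A)` exceeds `rank A` unless `μ A` is
-- a ⊤-variant.
rank-unfold : ∀ A → Proper 0 A → rank (unfold A) ≤ rank A
rank-unfold A p = rank-sub A λ { zero → inj₁ p ; (suc x) → inj₂ (x , refl) }

-- The finite closure of a formula

Closed : List PType → PType → Set
Closed L (var x) = ⊤
Closed L (A ⇒ B) = A ∈ L × B ∈ L
Closed L (• A)   = A ∈ L
Closed L (μ A)   = unfold A ∈ L

-- Each μ passed on the way down is recorded in the substitution, so that only
-- finitely many instances arise.
closure : (ℕ → PType) → PType → List PType
closure σ (var x) = σ x ∷ []
closure σ (A ⇒ B) = sub σ (A ⇒ B) ∷ closure σ A ++ closure σ B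
closure σ (• A)   = sub σ (• A) ∷ closure σ A
closure σ (μ A)   = sub σ (μ A) ∷ closure (sub σ (μ A) ◂ σ) A

sub∈closure : ∀ σ A → sub σ A ∈ closure σ A
sub∈closure σ (var x) = here refl
sub∈closure σ (A ⇒ B) = here refl
sub∈closure σ (• A)   = here refl
sub∈closure σ (μ A)   = here refl

-- `L` stays fixed during the recursion because the substitutes of variables may have their parts
-- outside the list of a subexpression.
closure-closed : ∀ {L} σ A → (∀ x → Closed L (σ x)) → closure σ A ⊆ L →
  ∀ {C} → C ∈ closure σ A → Closed L C
closure-closed σ (var x) h s (here refl) = h x
closure-closed σ (A ⇒ B) h s (here refl) =
  s (there (∈-++⁺ˡ (sub∈closure σ A))) , s (there (∈-++⁺ʳ (closure σ A) (sub∈closure σ B)))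
closure-closed σ (A ⇒ B) h s (there C∈) with ∈-++⁻ (closure σ A) C∈
... | inj₁ C∈A = closure-closed σ A h (s ∘ there ∘ ∈-++⁺ˡ) C∈A
... | inj₂ C∈B = closure-closed σ B h (s ∘ there ∘ ∈-++⁺ʳ (closure σ A)) C∈B
closure-closed σ (• A) h s (here refl) = s (there (sub∈closure σ A))
closure-closed σ (• A) h s (there C∈)  = closure-closed σ A h (s ∘ there) C∈
closure-closed {L} σ (μ A) h s C∈ = lemma C∈
  where
  u : PType
  u = sub σ (μ A)
  u-closed : Closed L u
  u-closed = subst (_∈ L) (sym (single-exts u σ A)) (s (there (sub∈closure (u ◂ σ) A)))
  lemma : ∀ {C} → C ∈ closure σ (μ A) → Closed L C
  lemma (here refl) = u-closed
  lemma (there C∈)  = closure-closed (u ◂ σ) A (λ { zero → u-closed ; (suc x) → h x }) (s ∘ there) C∈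

closure-IsFormula : ∀ σ A → (∀ x → IsFormula (σ x)) → IsFormula A → All IsFormula (closure σ A)
closure-IsFormula σ (var x) h f = h x ∷ []
closure-IsFormula σ (A ⇒ B) h (f , g) = IsFormula-sub h (A ⇒ B) (f , g) ∷
  Allₚ.++⁺ (closure-IsFormula σ A h f) (closure-IsFormula σ B h g)
closure-IsFormula σ (• A) h f = IsFormula-sub h (• A) f ∷ closure-IsFormula σ A h f
closure-IsFormula σ (μ A) h f = IsFormula-sub h (μ A) f ∷
  closure-IsFormula (sub σ (μ A) ◂ σ) A (λ { zero → IsFormula-sub h (μ A) f ; (suc x) → h x }) (proj₂ f)

-- Derived rules of LAμ

wfj : ∀ {Γ A} → Γ ⊢ A → WFJ Γ A
wfj (ax w _)       = w
wfj (•I w _ _)     = w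
wfj (••I w _)      = w
wfj (⇒I w _ _)     = w
wfj (⇒E w _ _ _)   = w
wfj (μI w _)       = w
wfj (μE w _)       = w
wfj (•⇒ w _)       = w
wfj (nec w _)      = w

weaken : ∀ {Γ Δ A} → All IsFormula Δ → Γ ⊆ Δ → Γ ⊢ A → Δ ⊢ A
weaken d s (ax (_ , f) A∈)     = ax (d , f) (s A∈)
weaken d s (•I (_ , f) D h)    = •I (d , f) D (s ∘ h)
weaken d s (••I (_ , f) D)     = ••I (d , f) (weaken d s D)
weaken {Δ = Δ} d s (⇒I {A = A} (_ , f) D (l , _)) = ⇒I (d , f) (weaken (proj₁ f ∷ d) sub′ D) (id , id)
  where
  sub′ : ∀ {C} → _ → C ∈ A ∷ Δ
  sub′ C∈ with l C∈
  ... | here e   = here e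
  ... | there C∈ = there (s C∈)
weaken {Δ = Δ} d s (⇒E {Γ₁ = Γ₁} (_ , f) D E (_ , r)) =
  ⇒E (d , f) (weaken d (s ∘ r ∘ ∈-++⁺ˡ) D) (weaken d (s ∘ r ∘ ∈-++⁺ʳ Γ₁) E)
    (∈-++⁺ˡ , [ id , id ]′ ∘ ∈-++⁻ Δ)
weaken d s (μI (_ , f) D)      = μI (d , f) (weaken d s D)
weaken d s (μE (_ , f) D)      = μE (d , f) (weaken d s D)
weaken d s (•⇒ (_ , f) D)      = •⇒ (d , f) (weaken d s D)
weaken d s (nec (_ , f) D)     = nec (d , f) (weaken d s D)

lam : ∀ {Γ A B} → A ∷ Γ ⊢ B → Γ ⊢ A ⇒ B
lam D with wfj D
... | f ∷ g , b = ⇒I (g , f , b) D (id , id)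

app : ∀ {Γ A B} → Γ ⊢ A ⇒ B → Γ ⊢ A → Γ ⊢ B
app {Γ} D E with wfj D
... | g , _ , b = ⇒E (g , b) D E (∈-++⁺ˡ , [ id , id ]′ ∘ ∈-++⁻ Γ)

hyp₀ : ∀ {Γ A} → All IsFormula (A ∷ Γ) → A ∷ Γ ⊢ A
hyp₀ g@(f ∷ _) = ax (g , f) (here refl)

hyp₁ : ∀ {Γ A B} → All IsFormula (A ∷ B ∷ Γ) → A ∷ B ∷ Γ ⊢ B
hyp₁ g@(_ ∷ f ∷ _) = ax (g , f) (there (here refl))

cuts : ∀ Γ {Δ A} → All IsFormula Δ → (∀ {C} → C ∈ Γ → Δ ⊢ C) → Γ ⊢ A → Δ ⊢ A
cuts []      d h D = weaken d (λ ()) D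
cuts (C ∷ Γ) d h D = app (cuts Γ d (h ∘ there) (lam D)) (h (here refl))

later : ∀ {Γ Δ A} → All IsFormula Δ → (∀ {C} → C ∈ Γ → Δ ⊢ • C) → Γ ⊢ A → Δ ⊢ • A
later {Γ} d h D = cuts (map •_ Γ) d cut
  (•I (Allₚ.map⁺ (proj₁ (wfj D)) , proj₂ (wfj D)) D (∈-map⁺ •_))
  where
  cut : ∀ {C} → C ∈ map •_ Γ → _
  cut C∈ with ∈-map⁻ •_ C∈
  ... | C′ , C′∈ , refl = h C′∈

•K : ∀ {Γ A B} → Γ ⊢ • (A ⇒ B) → Γ ⊢ • A → Γ ⊢ • B
•K D E with wfj D
... | g , f , f′ = later g (λ { (here refl) → E ; (there (here refl)) → D ; (there (there ())) })
  (app (hyp₁ (f ∷ (f , f′) ∷ [])) (hyp₀ (f ∷ (f , f′) ∷ [])))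

nec′ : ∀ {Γ A} → Γ ⊢ A → Γ ⊢ • A
nec′ D = nec (wfj D) D

-- The fixed point Y = μX. (•X) → A satisfies Y ⊢ •Y → A, hence •A → A ⊢ Y.
löb : ∀ {Γ A} → • A ∷ Γ ⊢ A → Γ ⊢ A
löb {Γ} {A} D with wfj D
... | g@(_ ∷ g′) , f = app (subst (λ C → Γ ⊢ (• Y) ⇒ C) (single-ren Y A) (μE (g′ , fU) Y-holds)) (nec′ Y-holds)
  where
  B Y : PType
  B = (• var 0) ⇒ ren suc A
  Y = μ B
  fY : IsFormula Y
  fY = inj₁ (tt , Proper-fresh (λ _ ()) A) , tt , IsFormula-ren A f
  fU : IsFormula (unfold B)
  fU = IsFormula-unfold B fY
  Y-unfold : Y ∷ [] ⊢ (• Y) ⇒ A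
  Y-unfold = subst (λ C → Y ∷ [] ⊢ (• Y) ⇒ C) (single-ren Y A) (μE (fY ∷ [] , fU) (hyp₀ (fY ∷ [])))
  wf• : All IsFormula (• Y ∷ Γ)
  wf• = fY ∷ g′
  -- Under a bullet `Y-unfold` gives •(•Y → A), and `nec` turns •Y into ••Y.
  •A-holds : • Y ∷ Γ ⊢ • A
  •A-holds = •K (later wf• (λ { (here refl) → hyp₀ wf• ; (there ()) }) Y-unfold) (nec′ (hyp₀ wf•))
  Y-holds : Γ ⊢ Y
  Y-holds = μI (g′ , fY) (subst (λ C → Γ ⊢ (• Y) ⇒ C) (sym (single-ren Y A))
    (lam (app (weaken wf• there (lam D)) •A-holds)))

-- bs is as in `tv`: the substitute of a binder below which no • has been passed
-- yet need only hold later.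
tv-derivable : ∀ bs {σ Γ} A → All IsFormula Γ → (∀ x → IsFormula (σ x)) → IsFormula A →
  (∀ i → i < length bs → Γ ⊢ (if lkp bs i then σ i else • σ i)) →
  T (tv bs (tail A)) → Γ ⊢ sub σ A
tv-derivable bs {σ} {Γ} (var x) g fσ f h t = lemma bs σ x h t
  where
  lemma : ∀ bs (σ : ℕ → PType) x → (∀ i → i < length bs → Γ ⊢ (if lkp bs i then σ i else • σ i)) →
    T (lkp bs x) → Γ ⊢ σ x
  lemma (true ∷ bs) σ zero    h t = h 0 z<s
  lemma (b ∷ bs)    σ (suc x) h t = lemma bs (σ ∘ suc) x (λ i i< → h (suc i) (s<s i<)) t
tv-derivable bs (A ⇒ B) g fσ (f , f′) h t =
  lam (weaken g′ there (tv-derivable bs B g fσ f′ h t))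
  where g′ = IsFormula-sub fσ A f ∷ g
tv-derivable bs {σ} {Γ} (• A) g fσ f h t =
  later g •Δ (tv-derivable (map (λ _ → true) bs) A wfΔ fσ f h′ t)
  where
  -- `Δ` lists the substitutes of all recorded binders. Each holds later, so below the bullet all of
  -- them may be assumed outright.
  Δ : ℕ → Ctx
  Δ zero    = []
  Δ (suc n) = σ n ∷ Δ n
  wfΔn : ∀ n → All IsFormula (Δ n)
  wfΔn zero    = []
  wfΔn (suc n) = fσ n ∷ wfΔn n
  wfΔ = wfΔn (length bs)
  ∈Δ⁺ : ∀ n i → i < n → σ i ∈ Δ n
  ∈Δ⁺ (suc n) i (s≤s i≤n) with ℕₚ.m≤n⇒m<n∨m≡n i≤n
  ... | inj₁ i<n  = there (∈Δ⁺ n i i<n)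
  ... | inj₂ refl = here refl
  ∈Δ⁻ : ∀ n {C} → C ∈ Δ n → ∃ λ i → i < n × C ≡ σ i
  ∈Δ⁻ (suc n) (here e)   = n , ℕₚ.≤-refl , e
  ∈Δ⁻ (suc n) (there C∈) with ∈Δ⁻ n C∈
  ... | i , i<n , e = i , ℕₚ.m≤n⇒m≤1+n i<n , e
  •σ : ∀ b {C} → Γ ⊢ (if b then C else • C) → Γ ⊢ • C
  •σ true  D = nec′ D
  •σ false D = D
  •Δ : ∀ {C} → C ∈ Δ (length bs) → Γ ⊢ • C
  •Δ C∈ with ∈Δ⁻ (length bs) C∈
  ... | i , i< , refl = •σ (lkp bs i) (h i i<)
  lkp-true : ∀ bs i → i < length bs → lkp (map (λ _ → true) bs) i ≡ true
  lkp-true (b ∷ bs) zero    _          = refl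
  lkp-true (b ∷ bs) (suc i) (s≤s i<) = lkp-true bs i i<
  h′ : ∀ i → i < length (map (λ _ → true) bs) →
    Δ (length bs) ⊢ (if lkp (map (λ _ → true) bs) i then σ i else • σ i)
  h′ i i< with subst (i <_) (length-map _ bs) i<
  ... | i<′ rewrite lkp-true bs i i<′ = ax (wfΔ , fσ i) (∈Δ⁺ (length bs) i i<′)
-- Löb's principle supplies `• u`, which is what the new entry `false` asks of the fresh binder.
tv-derivable bs {σ} {Γ} (μ A) g fσ f h t = löb (μI (wf• , fu) (subst (• u ∷ Γ ⊢_) (sym (single-exts u σ A))
  (tv-derivable (false ∷ bs) A wf• (λ { zero → fu ; (suc x) → fσ x }) (proj₂ f) h′ t)))
  where
  u = sub σ (μ A)
  fu = IsFormula-sub fσ (μ A) f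
  wf• : All IsFormula (• u ∷ Γ)
  wf• = fu ∷ g
  h′ : ∀ i → i < suc (length bs) →
    • u ∷ Γ ⊢ (if lkp (false ∷ bs) i then (u ◂ σ) i else • (u ◂ σ) i)
  h′ zero    _        = hyp₀ wf•
  h′ (suc i) (s≤s i<) = weaken wf• there (h i i<)

TopVariant-derivable : ∀ A → IsFormula A → TopVariant A → [] ⊢ A
TopVariant-derivable A f t = subst ([] ⊢_) (sub-id (λ _ → refl) A)
  (tv-derivable [] A [] (λ _ → tt) f (λ _ ()) t)

-- Existence of forcing

⇒-rankˡ : ∀ A B {r} → ¬ TopVariant (A ⇒ B) → rank (A ⇒ B) < suc r → rank A < r
⇒-rankˡ A B ¬t (s≤s r≤) rewrite rank-⇒ A B ¬t = ℕₚ.≤-trans (s≤s (ℕₚ.m≤m⊔n (rank A) (rank B))) r≤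

⇒-rankʳ : ∀ A B {r} → ¬ TopVariant (A ⇒ B) → rank (A ⇒ B) < suc r → rank B < r
⇒-rankʳ A B ¬t (s≤s r≤) rewrite rank-⇒ A B ¬t = ℕₚ.≤-trans (s≤s (ℕₚ.m≤n⊔m (rank A) (rank B))) r≤

μ-rank : ∀ A {r} → IsFormula (μ A) → ¬ TopVariant (μ A) → rank (μ A) < suc r → rank (unfold A) < r
μ-rank A (p , _) ¬t (s≤s r≤) rewrite rank-μ A ¬t = ℕₚ.≤-trans (s≤s (rank-unfold A p)) r≤

-- Forcing is built by recursion on level, then rank: a bullet lowers the level and may reset the
-- rank, while → and μ lower the rank and never raise the level.
module Forcing (𝓕 : LAFrame) (ξ : Valuation 𝓕) (level : W 𝓕 → ℕ)
  (R-level : ∀ {p q} → R 𝓕 p q → level q ≤ level p)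
  (▷-level : ∀ {p q} → _▷_ 𝓕 p q → level q < level p) where

  -- Meaningful only if k exceeds the level of the world and r the rank of the formula.
  ForcedWithin : ℕ → ℕ → W 𝓕 → PType → Set
  ForcedWithin k       r       p (var x) = ξ x p ≡ true
  ForcedWithin zero    r       p (• A)   = ⊤
  -- Here and in the clauses for → and μ, the guard makes ⊤-variants hold vacuously.
  ForcedWithin (suc k) r       p (• A)   =
    ¬ TopVariant (• A) → ∀ q → _▷_ 𝓕 p q → ForcedWithin k (suc (rank A)) q A
  ForcedWithin k       zero    p (A ⇒ B) = ⊤
  ForcedWithin k       (suc r) p (A ⇒ B) =
    ¬ TopVariant (A ⇒ B) → ∀ q → R 𝓕 p q → ForcedWithin k r q A → ForcedWithin k r q B
  ForcedWithin k       zero    p (μ A)   = ⊤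
  ForcedWithin k       (suc r) p (μ A)   =
    ¬ TopVariant (μ A) → ForcedWithin k r p (unfold A)

  Forced : W 𝓕 → PType → Set
  Forced p A = ForcedWithin (suc (level p)) (suc (rank A)) p A

  -- Needed because the clauses leave bounds at `q` that differ from those `Forced` chooses there.
  bounds-irrelevant : ∀ {k k′ r r′ p} A → IsFormula A → level p < k → level p < k′ →
    rank A < r → rank A < r′ → ForcedWithin k r p A → ForcedWithin k′ r′ p A
  bounds-irrelevant (var x) f k< k<′ r< r<′ F = F
  bounds-irrelevant {suc k} {suc k′} (• A) f (s≤s k≤) (s≤s k≤′) r< r<′ F ¬t q p▷q =
    bounds-irrelevant A f (ℕₚ.≤-trans (▷-level p▷q) k≤) (ℕₚ.≤-trans (▷-level p▷q) k≤′)
      ℕₚ.≤-refl ℕₚ.≤-refl (F ¬t q p▷q)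
  bounds-irrelevant {suc k} {suc k′} {suc r} {suc r′} (A ⇒ B) (f , g) k< k<′ r< r<′ F ¬t q pRq FA =
    bounds-irrelevant B g (below k<) (below k<′) (⇒-rankʳ A B ¬t r<) (⇒-rankʳ A B ¬t r<′)
      (F ¬t q pRq (bounds-irrelevant A f (below k<′) (below k<)
        (⇒-rankˡ A B ¬t r<′) (⇒-rankˡ A B ¬t r<) FA))
    where
    below : ∀ {k} → _ < k → level q < k
    below = ℕₚ.≤-trans (s≤s (R-level pRq))
  bounds-irrelevant {suc k} {suc k′} {suc r} {suc r′} (μ A) f k< k<′ r< r<′ F ¬t =
    bounds-irrelevant (unfold A) (IsFormula-unfold A f) k< k<′ (μ-rank A f ¬t r<) (μ-rank A f ¬t r<′) (F ¬t)

  Forced-TopVariant : ∀ p A → TopVariant A → Forced p A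
  Forced-TopVariant p (A ⇒ B) t ¬t = contradiction t ¬t
  Forced-TopVariant p (• A)   t ¬t = contradiction t ¬t
  Forced-TopVariant p (μ A)   t ¬t = contradiction t ¬t

  isForcing : IsForcing 𝓕 ξ Forced
  isForcing p A f = Forced-TopVariant p A , λ ¬t → to A f ¬t , from A f ¬t
    where
    to : ∀ A → IsFormula A → ¬ TopVariant A → Forced p A → Clause 𝓕 ξ Forced p A
    to (var x) f ¬t F = F
    to (• A)   f ¬t F q p▷q = bounds-irrelevant A f (▷-level p▷q) ℕₚ.≤-refl ℕₚ.≤-refl ℕₚ.≤-refl (F ¬t q p▷q)
    to (A ⇒ B) (f , g) ¬t F q pRq FA =
      bounds-irrelevant B g (s≤s (R-level pRq)) ℕₚ.≤-refl (⇒-rankʳ A B ¬t ℕₚ.≤-refl) ℕₚ.≤-refl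
        (F ¬t q pRq (bounds-irrelevant A f ℕₚ.≤-refl (s≤s (R-level pRq))
          ℕₚ.≤-refl (⇒-rankˡ A B ¬t ℕₚ.≤-refl) FA))
    to (μ A)   f ¬t F = bounds-irrelevant (unfold A) (IsFormula-unfold A f) ℕₚ.≤-refl ℕₚ.≤-refl
      (μ-rank A f ¬t ℕₚ.≤-refl) ℕₚ.≤-refl (F ¬t)
    from : ∀ A → IsFormula A → ¬ TopVariant A → Clause 𝓕 ξ Forced p A → Forced p A
    from (var x) f ¬t F = F
    from (• A)   f ¬t F _ q p▷q = bounds-irrelevant A f ℕₚ.≤-refl (▷-level p▷q) ℕₚ.≤-refl ℕₚ.≤-refl (F q p▷q)
    from (A ⇒ B) (f , g) ¬t F _ q pRq FA =
      bounds-irrelevant B g ℕₚ.≤-refl (s≤s (R-level pRq)) ℕₚ.≤-refl (⇒-rankʳ A B ¬t ℕₚ.≤-refl)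
        (F q pRq (bounds-irrelevant A f (s≤s (R-level pRq)) ℕₚ.≤-refl
          (⇒-rankˡ A B ¬t ℕₚ.≤-refl) ℕₚ.≤-refl FA))
    from (μ A)   f ¬t F _ = bounds-irrelevant (unfold A) (IsFormula-unfold A f) ℕₚ.≤-refl ℕₚ.≤-refl
      ℕₚ.≤-refl (μ-rank A f ¬t ℕₚ.≤-refl) F

-- The indexed calculus and its decidability

infix 4 _≟_
_≟_ : DecidableEquality PType
var x ≟ var y = map′ (cong var) (λ { refl → refl }) (x ℕₚ.≟ y)
(A ⇒ B) ≟ (C ⇒ D) = map′ (λ { (refl , refl) → refl }) (λ { refl → refl , refl }) (A ≟ C ×-dec B ≟ D)
(• A) ≟ (• B) = map′ (cong •_) (λ { refl → refl }) (A ≟ B)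
(μ A) ≟ (μ B) = map′ (cong μ_) (λ { refl → refl }) (A ≟ B)
var x ≟ (C ⇒ D) = no λ ()
var x ≟ (• B) = no λ ()
var x ≟ (μ B) = no λ ()
(A ⇒ B) ≟ var y = no λ ()
(A ⇒ B) ≟ (• C) = no λ ()
(A ⇒ B) ≟ (μ C) = no λ ()
(• A) ≟ var y = no λ ()
(• A) ≟ (C ⇒ D) = no λ ()
(• A) ≟ (μ B) = no λ ()
(μ A) ≟ var y = no λ ()
(μ A) ≟ (C ⇒ D) = no λ ()
(μ A) ≟ (• B) = no λ ()

open DecMembership (≡-dec _≟_ ℕₚ._≟_) using (_∈?_)

-- Drives two counts: of the indexed formulae a context lacks during the search, and of the formulae
-- •A a theory lacks during a descent.
remove : ∀ {a} {X : Set a} {x : X} {xs} → x ∈ xs →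
  ∃ λ ys → length xs ≡ suc (length ys) × (∀ {y} → y ∈ xs → y ≡ x ⊎ y ∈ ys)
remove {xs = x ∷ xs} (here refl) = xs , refl , λ { (here e) → inj₁ e ; (there y∈) → inj₂ y∈ }
remove {xs = z ∷ xs} (there x∈) with remove x∈
... | ys , e , h = z ∷ ys , cong suc e ,
  λ { (here e) → inj₂ (here e) ; (there y∈) → [ inj₁ , inj₂ ∘ there ]′ (h y∈) }

module Countermodel (Cl : List PType) (formulas : All IsFormula Cl)
  (closed : ∀ {C} → C ∈ Cl → Closed Cl C) where

  N : ℕ
  N = length Cl

  -- An indexed formula (A , i) asserts A at level i of a linear descent from level N;
  -- seen from level N, it reads •^(N-i) A.
  ICtx : Set
  ICtx = List (PType × ℕ)

  universe : ICtx
  universe = cartesianProduct Cl (upTo (suc N))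

  ∈universe : ∀ {A i} → A ∈ Cl → i ≤ N → (A , i) ∈ universe
  ∈universe A∈ i≤ = ∈-cartesianProduct⁺ A∈ (∈-upTo⁺ (s≤s i≤))

  universe⇒Cl : ∀ {A i} → (A , i) ∈ universe → A ∈ Cl
  universe⇒Cl = proj₁ ∘ ∈-cartesianProduct⁻ Cl (upTo (suc N))

  universe⇒≤ : ∀ {A i} → (A , i) ∈ universe → i ≤ N
  universe⇒≤ u = s≤s⁻¹ (∈-upTo⁻ (proj₂ (∈-cartesianProduct⁻ Cl (upTo (suc N)) u)))

  Elim : ICtx → PType → ℕ → PType × ℕ → Set
  Elim G A i (var x , j) = ⊥
  Elim G A i (B ⇒ C , j) = C ≡ A × j ≡ i × (B , i) ∈ G
  Elim G A i (• C , j)   = C ≡ A × j ≡ suc i × suc i ≤ N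
  Elim G A i (μ C , j)   = unfold C ≡ A × j ≡ i

  Intro : ICtx → PType → ℕ → Set
  Intro G (• A) i = i ≡ 0 ⊎ (A , pred i) ∈ G
  Intro G (μ A) i = (unfold A , i) ∈ G
  Intro G _     i = ⊥

  -- Premises are memberships in `G` rather than derivations, so a step is decided by inspection;
  -- `cut` recovers the rules with derived premises.
  Step : ICtx → PType → ℕ → Set
  Step G A i = TopVariant A ⊎ (suc i ≤ N × (A , suc i) ∈ G) ⊎ Any (Elim G A i) G ⊎ Intro G A i

  Below : ICtx → PType → ℕ → Set
  Below G A i = i ≡ 0 ⊎ (A , pred i) ∈ G

  infix 4 _⊩_at_
  -- With cut as a primitive rule, weakening is an instance of it; in a saturated context cut yields
  -- nothing beyond the members.
  data _⊩_at_ : ICtx → PType → ℕ → Set where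
    hyp  : ∀ {G A i} → (A , i) ∈ G → G ⊩ A at i
    cut  : ∀ {G H A i} → (∀ {B j} → (B , j) ∈ H → G ⊩ B at j) → H ⊩ A at i → G ⊩ A at i
    step : ∀ {G A i} → (A , i) ∈ universe → Step G A i → G ⊩ A at i
    ⇒I   : ∀ {G A B i} → (A ⇒ B , i) ∈ universe → Below G (A ⇒ B) i →
           (A , i) ∷ G ⊩ B at i → G ⊩ A ⇒ B at i

  ⊩-weaken : ∀ {G H A i} → G ⊆ H → G ⊩ A at i → H ⊩ A at i
  ⊩-weaken s = cut (hyp ∘ s)

  ⊩-cut₁ : ∀ {G B j A i} → G ⊩ B at j → (B , j) ∷ G ⊩ A at i → G ⊩ A at i
  ⊩-cut₁ d = cut λ { (here refl) → d ; (there m) → hyp m }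

  Elim-mono : ∀ {G H A i} u → G ⊆ H → Elim G A i u → Elim H A i u
  Elim-mono (B ⇒ C , j) s (e , e′ , B∈) = e , e′ , s B∈
  Elim-mono (• C , j)   s e = e
  Elim-mono (μ C , j)   s e = e

  Intro-mono : ∀ {G H} A {i} → G ⊆ H → Intro G A i → Intro H A i
  Intro-mono (• A) s = map₂⊎ s
  Intro-mono (μ A) s = s

  Step-mono : ∀ {G H} A {i} → G ⊆ H → Step G A i → Step H A i
  Step-mono A s (inj₁ t)                 = inj₁ t
  Step-mono A s (inj₂ (inj₁ (i< , A∈)))  = inj₂ (inj₁ (i< , s A∈))
  Step-mono A s (inj₂ (inj₂ (inj₁ e)))   with find e
  ... | u , u∈ , e = inj₂ (inj₂ (inj₁ (lose (s u∈) (Elim-mono u s e))))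
  Step-mono A s (inj₂ (inj₂ (inj₂ n)))   = inj₂ (inj₂ (inj₂ (Intro-mono A s n)))

  -- Decision by saturation

  Below? : ∀ G A i → Dec (Below G A i)
  Below? G A i = i ℕₚ.≟ 0 ⊎-dec (A , pred i) ∈? G

  Elim? : ∀ G A i u → Dec (Elim G A i u)
  Elim? G A i (var x , j) = no λ ()
  Elim? G A i (B ⇒ C , j) = C ≟ A ×-dec j ℕₚ.≟ i ×-dec (B , i) ∈? G
  Elim? G A i (• C , j)   = C ≟ A ×-dec j ℕₚ.≟ suc i ×-dec suc i ℕₚ.≤? N
  Elim? G A i (μ C , j)   = unfold C ≟ A ×-dec j ℕₚ.≟ i

  Intro? : ∀ G A i → Dec (Intro G A i)
  Intro? G (var x) i = no λ ()
  Intro? G (A ⇒ B) i = no λ ()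
  Intro? G (• A)   i = Below? G A i
  Intro? G (μ A)   i = (unfold A , i) ∈? G

  Step? : ∀ G A i → Dec (Step G A i)
  Step? G A i = TopVariant? A ⊎-dec (suc i ℕₚ.≤? N ×-dec (A , suc i) ∈? G)
    ⊎-dec any? (Elim? G A i) G ⊎-dec Intro? G A i

  -- ⇒I, except that a hypothesis already in G is not added again: the remaining
  -- premises then have strictly larger contexts, which makes the search terminate.
  AddImp : ICtx → PType → ℕ → Set
  AddImp G (A ⇒ B) i = Below G (A ⇒ B) i ×
    ((B , i) ∈ G ⊎ (A , i) ∈ universe × ¬ (A , i) ∈ G × (A , i) ∷ G ⊩ B at i)
  AddImp G _       i = ⊥

  Addable : ICtx → PType × ℕ → Set
  Addable G (A , i) = ¬ (A , i) ∈ G × (Step G A i ⊎ AddImp G A i)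

  Addable-sound : ∀ {G} A {i} → (A , i) ∈ universe → Addable G (A , i) → G ⊩ A at i
  Addable-sound A       u (_ , inj₁ s)                            = step u s
  Addable-sound (A ⇒ B) u (_ , inj₂ (b , inj₁ B∈))                = ⇒I u b (hyp (there B∈))
  Addable-sound (A ⇒ B) u (_ , inj₂ (b , inj₂ (_ , _ , d)))       = ⇒I u b d

  LargerDec : ICtx → Set
  LargerDec G = ∀ {A i} → (A , i) ∈ universe → ¬ (A , i) ∈ G → ∀ B j → Dec ((A , i) ∷ G ⊩ B at j)

  AddImp? : ∀ {G} → LargerDec G → ∀ A i → Dec (AddImp G A i)
  AddImp? larger (var x) i = no λ ()
  AddImp? larger (• A)   i = no λ ()
  AddImp? larger (μ A)   i = no λ ()
  AddImp? {G} larger (A ⇒ B) i = Below? G (A ⇒ B) i ×-dec ((B , i) ∈? G ⊎-dec premise)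
    where
    premise : Dec ((A , i) ∈ universe × ¬ (A , i) ∈ G × (A , i) ∷ G ⊩ B at i)
    premise with (A , i) ∈? universe | (A , i) ∈? G
    ... | no u∉  | _      = no (u∉ ∘ proj₁)
    ... | yes u∈ | yes m  = no λ (_ , m∉ , _) → m∉ m
    ... | yes u∈ | no m∉  = map′ (λ d → u∈ , m∉ , d) (proj₂ ∘ proj₂) (larger u∈ m∉ B i)

  Addable? : ∀ {G} → LargerDec G → ∀ u → Dec (Addable G u)
  Addable? {G} larger (A , i) = ¬? ((A , i) ∈? G) ×-dec (Step? G A i ⊎-dec AddImp? larger A i)

  -- Induction on the derivation; admitting any `H ⊆ G` lets the induction pass through `cut`, whose
  -- cut formulae are already members of `G`.
  saturated-complete : ∀ {G} → (∀ {u} → u ∈ universe → ¬ Addable G u) →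
    ∀ {H A i} → H ⊆ G → H ⊩ A at i → (A , i) ∈ G
  saturated-complete sat s (hyp m)  = s m
  saturated-complete sat s (cut h d) = saturated-complete sat (λ m → saturated-complete sat s (h m)) d
  saturated-complete {G} sat {A = A} {i} s (step u st) with (A , i) ∈? G
  ... | yes m = m
  ... | no m∉ = contradiction (m∉ , inj₁ (Step-mono A s st)) (sat u)
  saturated-complete {G} sat s (⇒I {A = A} {B} {i} u b d) with (A ⇒ B , i) ∈? G
  ... | yes m = m
  -- If `A` is already present, the premise lives inside `G` and induction puts `B` there; otherwise
  -- the premise has a strictly larger context.
  ... | no m∉ with (A , i) ∈? G
  ...   | yes A∈ = contradiction (m∉ , inj₂ (map₂⊎ s b , inj₁
            (saturated-complete sat (λ { (here refl) → A∈ ; (there m) → s m }) d))) (sat u)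
  ...   | no A∉  = contradiction (m∉ , inj₂ (map₂⊎ s b , inj₂
            (∈universe (proj₁ (closed (universe⇒Cl u))) (universe⇒≤ u) , A∉ ,
              ⊩-weaken (λ { (here e) → here e ; (there m) → there (s m) }) d))) (sat u)

  -- Adding a derivable formula changes nothing, by cut and weakening; if none can be added,
  -- derivability is membership.
  decideWith : ∀ G → LargerDec G → ∀ A i → Dec (G ⊩ A at i)
  decideWith G larger A i with any? (Addable? larger) universe
  ... | no none = map′ hyp (saturated-complete (λ u∈ a → none (lose u∈ a)) id) ((A , i) ∈? G)
  ... | yes some with find some
  ...   | (B , j) , u∈ , a@(m∉ , _) =
          map′ (⊩-cut₁ (Addable-sound B u∈ a)) (⊩-weaken there) (larger u∈ m∉ A i)

  mutual

    -- `rest` covers what `G` may still lack of the universe and loses an entry with each formula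
    -- added.
    decide : ∀ n G rest → length rest ≡ n → (∀ {u} → u ∈ universe → u ∈ G ⊎ u ∈ rest) →
      ∀ A i → Dec (G ⊩ A at i)
    decide n G rest len cover = decideWith G (decide-larger n G rest len cover)

    decide-larger : ∀ n G rest → length rest ≡ n → (∀ {u} → u ∈ universe → u ∈ G ⊎ u ∈ rest) →
      LargerDec G
    decide-larger n G rest len cover u∈ m∉ with cover u∈
    ... | inj₁ m = contradiction m m∉
    decide-larger zero    G (_ ∷ _) () cover u∈ m∉ | inj₂ m
    decide-larger (suc n) G rest len cover u∈ m∉   | inj₂ m with remove m
    ... | rest′ , e , h = decide n _ rest′ (ℕₚ.suc-injective (trans (sym e) len))
          ([ inj₁ ∘ there , [ inj₁ ∘ here , inj₂ ]′ ∘ h ]′ ∘ cover)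

  infix 4 _⊩?_at_
  _⊩?_at_ : ∀ G A i → Dec (G ⊩ A at i)
  G ⊩? A at i = decide _ G universe refl inj₂ A i

  -- Theories and descent between them

  record Theory : Set₁ where
    field
      Mem        : PType → Set
      isFormula  : ∀ {A} → Mem A → IsFormula A
      deductive  : ∀ {Γ A} → (∀ {C} → C ∈ Γ → Mem C) → Γ ⊢ A → Mem A

  open Theory using (isFormula; deductive)

  infix 4 _∋_ _⊑_ _↓_
  _∋_ : Theory → PType → Set
  p ∋ A = Theory.Mem p A

  _⊑_ : Theory → Theory → Set
  p ⊑ q = ∀ {A} → p ∋ A → q ∋ A

  _↓_ : Theory → Theory → Set
  p ↓ q = ∀ {A} → p ∋ • A → q ∋ A

  deductive₁ : ∀ p {A B} → p ∋ A → A ∷ [] ⊢ B → p ∋ B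
  deductive₁ p a = deductive p λ { (here refl) → a ; (there ()) }

  deductive₂ : ∀ p {A B C} → p ∋ A → p ∋ B → A ∷ B ∷ [] ⊢ C → p ∋ C
  deductive₂ p a b = deductive p λ
    { (here refl) → a ; (there (here refl)) → b ; (there (there ())) }

  ∋-mp : ∀ p {A B} → p ∋ A ⇒ B → p ∋ A → p ∋ B
  ∋-mp p ab a with isFormula p ab
  ... | f = deductive₂ p ab a (app (hyp₀ (f ∷ proj₁ f ∷ [])) (hyp₁ (f ∷ proj₁ f ∷ [])))

  ∋-nec : ∀ p {A} → p ∋ A → p ∋ • A
  ∋-nec p a = deductive₁ p a (nec′ (hyp₀ (isFormula p a ∷ [])))

  theory : ∀ Γ → All IsFormula Γ → Theory
  theory Γ g = record
    { Mem       = Γ ⊢_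
    ; isFormula = proj₂ ∘ wfj
    ; deductive = cuts _ g }

  -- The least descent from `p`: by definition `p ↓ q` says `next p ⊑ q`.
  next : Theory → Theory
  next p = record
    { Mem       = λ A → p ∋ • A
    ; isFormula = isFormula p
    ; deductive = λ {Γ} h D → deductive p {map •_ Γ}
        (λ C∈ → case-map (∈-map⁻ •_ C∈) h)
        (later (Allₚ.map⁺ (proj₁ (wfj D)))
          (λ C∈ → ax (Allₚ.map⁺ (proj₁ (wfj D)) , All.lookup (proj₁ (wfj D)) C∈) (∈-map⁺ •_ C∈)) D) }
    where
    case-map : ∀ {Γ C} → (∃ λ B → B ∈ Γ × C ≡ • B) → (∀ {B} → B ∈ Γ → p ∋ • B) → p ∋ C
    case-map (_ , B∈ , refl) h = h B∈

  ⊑-next : ∀ p → p ⊑ next p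
  ⊑-next p = ∋-nec p

  -- By the deduction theorem, the theory generated by `p` and `A`.
  assume : ∀ (p : Theory) A → IsFormula A → Theory
  assume p A f = record
    { Mem       = λ B → p ∋ A ⇒ B
    ; isFormula = proj₂ ∘ isFormula p
    ; deductive = λ {Γ} h D → deductive p {map (A ⇒_) Γ}
        (λ C∈ → case-map (∈-map⁻ (A ⇒_) C∈) h) (discharge D) }
    where
    case-map : ∀ {Γ C} → (∃ λ B → B ∈ Γ × C ≡ A ⇒ B) → (∀ {B} → B ∈ Γ → p ∋ A ⇒ B) → p ∋ C
    case-map (_ , B∈ , refl) h = h B∈
    discharge : ∀ {Γ B} → Γ ⊢ B → map (A ⇒_) Γ ⊢ A ⇒ B
    discharge {Γ} D = lam (cuts Γ wf (λ C∈ →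
        app (ax (wf , f , All.lookup g C∈) (there (∈-map⁺ (A ⇒_) C∈))) (hyp₀ wf)) D)
      where
      g = proj₁ (wfj D)
      wf : All IsFormula (A ∷ map (A ⇒_) Γ)
      wf = f ∷ Allₚ.map⁺ (All.map (f ,_) g)

  assumed : ∀ p {A} f → assume p A f ∋ A
  assumed p f = deductive p {[]} (λ ()) (lam (hyp₀ (f ∷ [])))

  ⊑-assume : ∀ p {A} f → p ⊑ assume p A f
  ⊑-assume p f b = deductive₁ p b (lam (hyp₁ (f ∷ isFormula p b ∷ [])))

  -- The least extension r of p with r ↓ q.
  lift : Theory → Theory → Theory
  lift p q = record
    { Mem       = Mem′
    ; isFormula = λ (_ , _ , _ , _ , D) → proj₂ (wfj D)
    ; deductive = λ {Γ} h D → let P , Q , P⊆ , Q⊆ , g , k = gather Γ h in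
        P , Q , P⊆ , Q⊆ , cuts Γ g k D }
    where
    Mem′ : PType → Set
    Mem′ A = Σ Ctx λ P → Σ Ctx λ Q →
      (∀ {C} → C ∈ P → p ∋ C) × (∀ {C} → C ∈ Q → q ∋ C) × (P ++ map •_ Q ⊢ A)
    -- Finitely many members use finite parts of `p` and `q`, whose unions serve as one context for
    -- all of `Γ`.
    gather : ∀ Γ → (∀ {C} → C ∈ Γ → Mem′ C) → Σ Ctx λ P → Σ Ctx λ Q →
      (∀ {C} → C ∈ P → p ∋ C) × (∀ {C} → C ∈ Q → q ∋ C) ×
      All IsFormula (P ++ map •_ Q) × (∀ {C} → C ∈ Γ → P ++ map •_ Q ⊢ C)
    gather []      h = [] , [] , (λ ()) , (λ ()) , [] , λ ()
    gather (A ∷ Γ) h with h (here refl) | gather Γ (h ∘ there)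
    ... | P , Q , P⊆ , Q⊆ , D | P′ , Q′ , P′⊆ , Q′⊆ , g , k =
      P ++ P′ , Q ++ Q′ , [ P⊆ , P′⊆ ]′ ∘ ∈-++⁻ P , [ Q⊆ , Q′⊆ ]′ ∘ ∈-++⁻ Q , wf ,
      λ { (here refl) → weaken wf left D ; (there C∈) → weaken wf right (k C∈) }
      where
      left : P ++ map •_ Q ⊆ (P ++ P′) ++ map •_ (Q ++ Q′)
      left C∈ with ∈-++⁻ P C∈
      ... | inj₁ m = ∈-++⁺ˡ (∈-++⁺ˡ m)
      ... | inj₂ m with ∈-map⁻ •_ m
      ...   | _ , m′ , refl = ∈-++⁺ʳ (P ++ P′) (∈-map⁺ •_ (∈-++⁺ˡ m′))
      right : P′ ++ map •_ Q′ ⊆ (P ++ P′) ++ map •_ (Q ++ Q′)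
      right C∈ with ∈-++⁻ P′ C∈
      ... | inj₁ m = ∈-++⁺ˡ (∈-++⁺ʳ P m)
      ... | inj₂ m with ∈-map⁻ •_ m
      ...   | _ , m′ , refl = ∈-++⁺ʳ (P ++ P′) (∈-map⁺ •_ (∈-++⁺ʳ Q m′))
      wf : All IsFormula ((P ++ P′) ++ map •_ (Q ++ Q′))
      wf = All.tabulate λ C∈ → wf-at (∈-++⁻ (P ++ P′) C∈)
        where
        wf-at : ∀ {C} → C ∈ P ++ P′ ⊎ C ∈ map •_ (Q ++ Q′) → IsFormula C
        wf-at (inj₁ m) = isFormula p ([ P⊆ , P′⊆ ]′ (∈-++⁻ P m))
        wf-at (inj₂ m) with ∈-map⁻ •_ m
        ... | _ , m′ , refl = isFormula q ([ Q⊆ , Q′⊆ ]′ (∈-++⁻ Q m′))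

  ⊑-lift : ∀ p q → p ⊑ lift p q
  ⊑-lift p q a = _ ∷ [] , [] , (λ { (here refl) → a ; (there ()) }) , (λ ()) , hyp₀ (isFormula p a ∷ [])

  ⊑-next-lift : ∀ p q → q ⊑ next (lift p q)
  ⊑-next-lift p q a = [] , _ ∷ [] , (λ ()) , (λ { (here refl) → a ; (there ()) }) , hyp₀ (isFormula q a ∷ [])

  -- Here •A → •B ⊢ •(A → B) is needed.
  lift-↓ : ∀ p q → p ↓ q → lift p q ↓ q
  lift-↓ p q p↓q (P , Q , P⊆ , Q⊆ , D) = go Q Q⊆ D
    where
    go : ∀ Q → (∀ {C} → C ∈ Q → q ∋ C) → ∀ {A} → P ++ map •_ Q ⊢ • A → q ∋ A
    go []      Q⊆ D = p↓q (deductive p P⊆′ D)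
      where
      P⊆′ : ∀ {C} → C ∈ P ++ [] → p ∋ C
      P⊆′ C∈ = [ P⊆ , (λ ()) ]′ (∈-++⁻ P C∈)
    -- The hypothesis `• C` is moved across: •C → •A becomes •(C → A), so `C ⇒ A` lies in `q` by
    -- recursion, and `C` does too.
    go (C ∷ Q) Q⊆ {A} D = ∋-mp q (go Q (Q⊆ ∘ there) (•⇒ (g′ , f′) (lam D′))) (Q⊆ (here refl))
      where
      g′ : All IsFormula (P ++ map •_ Q)
      g′ = Allₚ.++⁺ (Allₚ.++⁻ˡ P (proj₁ (wfj D))) (All.tail (Allₚ.++⁻ʳ P (proj₁ (wfj D))))
      fC : IsFormula C
      fC = isFormula q (Q⊆ (here refl))
      f′ : IsFormula (C ⇒ A)
      f′ = fC , proj₂ (wfj D)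
      move : P ++ • C ∷ map •_ Q ⊆ • C ∷ P ++ map •_ Q
      move C∈ with ∈-++⁻ P C∈
      ... | inj₁ m         = there (∈-++⁺ˡ m)
      ... | inj₂ (here e)  = here e
      ... | inj₂ (there m) = there (∈-++⁺ʳ P m)
      D′ : • C ∷ P ++ map •_ Q ⊢ • A
      D′ = weaken (fC ∷ g′) move D

  -- Good n p: descents of length at most n suffice to refute, at any extension of p,
  -- the formulae •A in Cl that it does not contain.
  Good : ℕ → Theory → Set₁
  Good zero    p = ∀ q → p ⊑ q → ∀ A → • A ∈ Cl → q ∋ • A
  Good (suc n) p = ∀ q → p ⊑ q → ∀ A → • A ∈ Cl →
    (∀ s → q ↓ s → Good n s → s ∋ A) → q ∋ • A

  Good-mono : ∀ n {p q} → p ⊑ q → Good n p → Good n q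
  Good-mono zero    p⊑q G r q⊑r = G r (q⊑r ∘ p⊑q)
  Good-mono (suc n) p⊑q G r q⊑r = G r (q⊑r ∘ p⊑q)

  -- For an extension `r` of the lift, the single descent `next r` suffices: it is good because it
  -- contains `q`, and `A` lies in it only if `• A` lies in `r`.
  Good-lift : ∀ n p q → Good n q → Good (suc n) (lift p q)
  Good-lift n p q G r l⊑r A m h =
    h (next r) id (Good-mono n (λ a → l⊑r (⊑-next-lift p q a)) G)

  -- Each descent makes one more •A in Cl true: by Löb's principle, •A may be assumed
  -- when refuting A below a theory that refutes •A.
  Good-missing : ∀ Z p → (∀ {A} → • A ∈ Cl → • A ∈ Z ⊎ p ∋ • A) → ∀ n → length Z ≡ n → Good n p
  Good-missing [] p h zero e q p⊑q A m with h m
  ... | inj₂ a = p⊑q a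
  Good-missing Z p h (suc n) e q p⊑q A m k with h m
  ... | inj₂ a  = p⊑q a
  ... | inj₁ m′ with remove m′
  -- That `A` belongs to `s` means that •(•A → A) belongs to `q`; Löb's principle under the bullet
  -- then gives •A.
  ...   | Z′ , e′ , split = deductive₁ q (k s (⊑-assume (next q) f) good) (later ((f , f) ∷ []) hyp• löb-A)
    where
    f : IsFormula A
    f = All.lookup formulas m
    s : Theory
    s = assume (next q) (• A) f
    s-• : ∀ {B} → • B ∈ Z ⊎ p ∋ • B → • B ∈ Z′ ⊎ s ∋ • B
    s-• (inj₂ b) = inj₂ (⊑-assume (next q) f (⊑-next q (p⊑q b)))
    s-• (inj₁ b) with split b
    ... | inj₁ refl = inj₂ (assumed (next q) f)
    ... | inj₂ b′   = inj₁ b′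
    good : Good n s
    good = Good-missing Z′ s (s-• ∘ h) n (ℕₚ.suc-injective (trans (sym e′) e))
    löb-A : (• A) ⇒ A ∷ [] ⊢ A
    löb-A = löb (app (hyp₁ (f ∷ (f , f) ∷ [])) (hyp₀ (f ∷ (f , f) ∷ [])))
    hyp• : ∀ {C} → C ∈ (• A) ⇒ A ∷ [] → • ((• A) ⇒ A) ∷ [] ⊢ • C
    hyp• (here refl) = hyp₀ ((f , f) ∷ [])
    hyp• (there ())

  Good-N : ∀ p → Good N p
  Good-N p = Good-missing Cl p inj₁ N refl

  -- Only good theories are visited, so the `i` levels still below `q` suffice to refute the
  -- formulae •A in `Cl` that it lacks.
  data Path (p : Theory) : ℕ → Theory → Set₁ where
    stop : ∀ {i} → i ≡ N → Path p i p
    down : ∀ {i r q} → Path p (suc i) r → r ↓ q → Good i q → Path p i q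

  Path-≤ : ∀ {p i q} → Path p i q → i ≤ N
  Path-≤ (stop e)      = ℕₚ.≤-reflexive e
  Path-≤ (down π _ _)  = ℕₚ.<⇒≤ (Path-≤ π)

  Path-Good : ∀ {p i q} → Path p i q → Good i q
  Path-Good (stop refl)  = Good-N _
  Path-Good (down _ _ g) = g

  HoldsAt : Theory → PType → ℕ → Set₁
  HoldsAt p A i = ∀ q → Path p i q → q ∋ A

  -- A path from `p′` becomes one from `p` by changing its start alone, as a descent from `p′` is
  -- also one from the smaller `p`.
  HoldsAt-mono : ∀ {p p′ A i} → p ⊑ p′ → HoldsAt p A i → HoldsAt p′ A i
  HoldsAt-mono p⊑p′ h q (stop e) = p⊑p′ (h _ (stop e))
  HoldsAt-mono {p} {p′} p⊑p′ h q (down π l g) = h q (restart π l g)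
    where
    restart : ∀ {i r q} → Path p′ (suc i) r → r ↓ q → Good i q → Path p i q
    restart         (stop e)       l g = down (stop e) (l ∘ p⊑p′) g
    restart {r = r} (down π l′ g′) l g = down {r = r} (restart π l′ g′) l g

  -- The frame condition on ▷ and R, iterated along a path.
  raise : ∀ {p i q} → Path p i q → ∀ q′ → q ⊑ q′ → Good i q′ →
    Σ Theory λ p′ → p ⊑ p′ × Path p′ i q′ × (∀ s → Path p′ i s → q′ ⊑ s)
  raise {p} (stop refl) q′ q⊑q′ g = q′ , q⊑q′ , stop refl , least
    where
    least : ∀ s → Path q′ N s → q′ ⊑ s
    least s (stop _)     = id
    least s (down π _ _) = ⊥-elim (ℕₚ.<-irrefl refl (Path-≤ π))
  -- The predecessor `r` grows to `lift r q′`: it contains `• A` for each `A` in `q′`, so every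
  -- descent from its extensions contains `q′`.
  raise {p} {i} (down {r = r} {q = q} π l g) q′ q⊑q′ g′
    with raise π (lift r q′) (⊑-lift r q′) (Good-lift i r q′ g′)
  ... | p′ , p⊑p′ , π′ , least′ = p′ , p⊑p′ , down π′ (lift-↓ r q′ (q⊑q′ ∘ l)) g′ , least i least′ (Path-≤ π′)
    where
    least : ∀ i → (∀ s → Path p′ (suc i) s → lift r q′ ⊑ s) → suc i ≤ N → ∀ s → Path p′ i s → q′ ⊑ s
    least i least′ i< s (stop e)           = ⊥-elim (ℕₚ.<-irrefl e i<)
    least i least′ i< s (down π″ l″ g″) a = l″ (least′ _ π″ (⊑-next-lift r q′ a))

  HoldsAt-down : ∀ {p i q A B} → suc i ≤ N → (∀ r → r ∋ A → r ↓ q → q ∋ B) →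
    HoldsAt p A (suc i) → Path p i q → q ∋ B
  HoldsAt-down i< k h (stop e)     = ⊥-elim (ℕₚ.<-irrefl e i<)
  HoldsAt-down i< k h (down {r = r} π l g) = k r (h r π) l

  -- Soundness of the indexed calculus

  universe-formula : ∀ {A i} → (A , i) ∈ universe → IsFormula A
  universe-formula u = All.lookup formulas (universe⇒Cl u)

  sound : ∀ {G A i} → G ⊩ A at i →
    ∀ p → (∀ {B j} → (B , j) ∈ G → HoldsAt p B j) → HoldsAt p A i
  sound (hyp m)   p h = h m
  sound (cut k d) p h = sound d p λ m → sound (k m) p h
  sound {A = A} (step u (inj₁ t)) p h q π =
    deductive q (λ ()) (TopVariant-derivable A (universe-formula u) t)
  sound (step u (inj₂ (inj₁ (i< , m)))) p h q π =
    HoldsAt-down i< (λ r a l → l (∋-nec r a)) (h m) π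
  sound {G} {A} {i} (step u (inj₂ (inj₂ (inj₁ e)))) p h q π with find e
  ... | (B ⇒ C , j) , m , refl , refl , m′ = ∋-mp q (h m q π) (h m′ q π)
  ... | (• C , j)   , m , refl , refl , i< = HoldsAt-down i< (λ r a l → l a) (h m) π
  ... | (μ C , j)   , m , refl , refl      = deductive₁ q (h m q π)
        (μE (f ∷ [] , IsFormula-unfold C f) (hyp₀ (f ∷ [])))
    where f = isFormula q (h m q π)
  -- Goodness of `q` yields `• A`: at once at level 0, and above it because every good descent of
  -- `q` prolongs the path.
  sound {A = • A} {zero}  (step u (inj₂ (inj₂ (inj₂ n)))) p h q π =
    Path-Good π q id A (universe⇒Cl u)
  sound {A = • A} {suc i} (step u (inj₂ (inj₂ (inj₂ (inj₂ m))))) p h q π =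
    Path-Good π q id A (universe⇒Cl u) λ s q↓s g → h m s (down π q↓s g)
  sound {A = μ A} (step u (inj₂ (inj₂ (inj₂ m)))) p h q π = deductive₁ q a
    (μI (isFormula q a ∷ [] , universe-formula u) (hyp₀ (isFormula q a ∷ [])))
    where a = h m q π
  -- The path is raised to end in `assume q A`, and all paths from its new start `p′` to level `i`
  -- end in theories containing `A`. Finding `B` in `assume q A` means `A ⇒ B` is in `q`.
  sound {G} {i = i} (⇒I {A = A} {B} u _ d) p h q π
    with raise π (assume q A fA) (⊑-assume q fA) (Good-mono i (⊑-assume q fA) (Path-Good π))
    where fA = proj₁ (universe-formula u)
  ... | p′ , p⊑p′ , π′ , least = sound d p′ h′ _ π′
    where
    h′ : ∀ {C j} → (C , j) ∈ (A , i) ∷ G → HoldsAt p′ C j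
    h′ (here refl) s πs = least s πs (assumed q (proj₁ (universe-formula u)))
    h′ (there m)        = HoldsAt-mono p⊑p′ (h m)

  at-N : Ctx → ICtx
  at-N = map (_, N)

  ⊩⇒⊢ : ∀ {Γ A} → All IsFormula Γ → at-N Γ ⊩ A at N → Γ ⊢ A
  ⊩⇒⊢ {Γ} g d = sound d (theory Γ g) top (theory Γ g) (stop refl)
    where
    top : ∀ {B j} → (B , j) ∈ at-N Γ → HoldsAt (theory Γ g) B j
    top m with ∈-map⁻ (_, N) m
    ... | _ , B∈ , refl = HoldsAt-top (ax (g , All.lookup g B∈) B∈)
      where
      HoldsAt-top : ∀ {p B} → p ∋ B → HoldsAt p B N
      HoldsAt-top b q (stop _)     = b
      HoldsAt-top b q (down π _ _) = ⊥-elim (ℕₚ.<-irrefl refl (Path-≤ π))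

  -- The frame of indexed contexts with a current level

  World : Set
  World = ICtx × ∃ λ n → n ≤ N

  level : World → ℕ
  level (_ , n , _) = n

  no-descent : (f : ℕ → ℕ) → ¬ (∀ n → f (suc n) < f n)
  no-descent f desc = ℕₚ.<-irrefl refl (ℕₚ.≤-trans (ℕₚ.m≤n+m _ _) (bound (suc (f 0))))
    where
    bound : ∀ n → f n + n ≤ f 0
    bound zero    = ℕₚ.≤-reflexive (ℕₚ.+-identityʳ _)
    bound (suc n) = ℕₚ.≤-trans (ℕₚ.≤-reflexive (ℕₚ.+-suc _ n))
      (ℕₚ.≤-trans (ℕₚ.+-monoˡ-≤ n (desc n)) (bound n))

  frame : LAFrame
  frame = record
    { W        = World
    ; _▷_      = λ (G , n , _) (H , m , _) → G ⊆ H × m < n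
    ; R        = λ (G , n , _) (H , m , _) → G ⊆ H × m ≤ n
    ; nonempty = [] , 0 , z≤n
    ; noChain  = λ (f , desc) → no-descent (level ∘ f) (proj₂ ∘ desc)
    ; R-refl   = λ _ → id , ℕₚ.≤-refl
    ; R-trans  = λ (s , l) (s′ , l′) → s′ ∘ s , ℕₚ.≤-trans l′ l
    ; R▷⇒▷     = λ (s , l) (s′ , l′) → s′ ∘ s , ℕₚ.<-≤-trans l′ l
    ; ▷⇒R      = λ (s , l) → s , ℕₚ.<⇒≤ l
    -- The witness keeps the context of `q′` and sits one level above it, so all it sees has at most
    -- the level of `q′`.
    ; ▷R       = λ {p} {_} {q′} (s , l) (s′ , l′) →
        let m<n = ℕₚ.≤-<-trans l′ l in
        (proj₁ q′ , suc (level q′) , ℕₚ.≤-trans m<n (proj₂ (proj₂ p))) ,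
        (s′ ∘ s , m<n) , (id , ℕₚ.≤-refl) , λ _ (s″ , l″) → s″ , s≤s⁻¹ l″
    }

  Valid : ℕ → World → Set
  Valid x (G , n , _) = (var x , n) ∈ universe × G ⊩ var x at n

  valid? : ∀ x p → Dec (Valid x p)
  valid? x (G , n , _) = (var x , n) ∈? universe ×-dec G ⊩? var x at n

  -- Valuations are Boolean; this is where decidability of the indexed calculus enters.
  valuation : Valuation frame
  valuation x p = does (valid? x p)

  valuation⇒Valid : ∀ {x} p → valuation x p ≡ true → Valid x p
  valuation⇒Valid {x} p = witness (valid? x p)
    where
    witness : ∀ {P : Set} (P? : Dec P) → does P? ≡ true → P
    witness (yes w) _ = w

  ⊩-lower : ∀ {G A m n} → A ∈ Cl → n ≤ N → m ≤ n → G ⊩ A at n → G ⊩ A at m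
  ⊩-lower {n = zero}  A∈ n≤ z≤n d = d
  ⊩-lower {n = suc n} A∈ n≤ m≤ d with ℕₚ.m≤n⇒m<n∨m≡n m≤
  ... | inj₂ refl = d
  ... | inj₁ m<   = ⊩-lower A∈ (ℕₚ.<⇒≤ n≤) (s≤s⁻¹ m<)
        (⊩-cut₁ d (step (∈universe A∈ (ℕₚ.<⇒≤ n≤)) (inj₂ (inj₁ (n≤ , here refl)))))

  hereditary : Hereditary frame valuation
  hereditary x p@(_ , _ , n≤) q@(_ , _ , m≤) (s , m≤n) e with valuation⇒Valid p e
  ... | u , d = dec-true (valid? x q)
        (∈universe (universe⇒Cl u) m≤ , ⊩-weaken s (⊩-lower (universe⇒Cl u) n≤ m≤n d))

  -- The truth lemma

  open Forcing frame valuation level proj₂ proj₂ using (Forced; isForcing)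

  ⊩-elim : ∀ {G u A i} → (A , i) ∈ universe → G ⊩ proj₁ u at proj₂ u →
    (∀ {H} → G ⊆ H → Elim H A i u) → G ⊩ A at i
  ⊩-elim u d e = ⊩-cut₁ d (step u (inj₂ (inj₂ (inj₁ (here (e there))))))

  module Truth {Fo : World → PType → Set} (forcing : IsForcing frame valuation Fo) where

    -- Induction on the bounds `k` for the level, then `r` for the rank. Both directions go together
    -- because → uses its antecedent contravariantly.
    truth : ∀ k r p A → A ∈ Cl → level p < k → rank A < r →
      (proj₁ p ⊩ A at level p → Fo p A) × (Fo p A → proj₁ p ⊩ A at level p)
    ⊩⇒Clause : ∀ k r p A → A ∈ Cl → ¬ TopVariant A → level p < k → rank A < r →
      proj₁ p ⊩ A at level p → Clause frame valuation Fo p A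
    Clause⇒⊩ : ∀ k r p A → A ∈ Cl → ¬ TopVariant A → level p < k → rank A < r →
      Clause frame valuation Fo p A → proj₁ p ⊩ A at level p

    truth k r p A A∈ k< r< with TopVariant? A
    ... | yes t = (λ _ → proj₁ (forcing p A (All.lookup formulas A∈)) t) ,
                  (λ _ → step (∈universe A∈ (proj₂ (proj₂ p))) (inj₁ t))
    ... | no ¬t with proj₂ (forcing p A (All.lookup formulas A∈)) ¬t
    ...   | toClause , fromClause =
            (λ d → fromClause (⊩⇒Clause k r p A A∈ ¬t k< r< d)) ,
            (λ F → Clause⇒⊩ k r p A A∈ ¬t k< r< (toClause F))

    ⊩⇒Clause k r p (var x) A∈ ¬t k< r< d =
      dec-true (valid? x p) (∈universe A∈ (proj₂ (proj₂ p)) , d)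
    ⊩⇒Clause (suc k) r (G , suc n , n≤) (• A) A∈ ¬t (s≤s k≤) r< d q@(H , m , m≤) (s , s≤s l) =
      proj₁ (truth k (suc (rank A)) q A (closed A∈) (ℕₚ.≤-trans (s≤s l) k≤) ℕₚ.≤-refl)
        (⊩-weaken s (⊩-lower (closed A∈) (ℕₚ.<⇒≤ n≤) l
          (⊩-elim (∈universe (closed A∈) (ℕₚ.<⇒≤ n≤)) d (λ _ → refl , refl , n≤))))
    ⊩⇒Clause k (suc r) (G , n , n≤) (A ⇒ B) A∈ ¬t k< r< d q@(H , m , m≤) (s , l) FA =
      proj₁ (truth k r q B (proj₂ (closed A∈)) (ℕₚ.≤-trans (s≤s l) k<) (⇒-rankʳ A B ¬t r<))
        (⊩-cut₁ (proj₂ (truth k r q A (proj₁ (closed A∈)) (ℕₚ.≤-trans (s≤s l) k<) (⇒-rankˡ A B ¬t r<)) FA)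
          (⊩-elim (∈universe (proj₂ (closed A∈)) m≤)
            (⊩-weaken (there ∘ s) (⊩-lower A∈ n≤ l d))
            (λ s′ → refl , refl , s′ (here refl))))
    ⊩⇒Clause k (suc r) p@(_ , _ , n≤) (μ A) A∈ ¬t k< r< d =
      proj₁ (truth k r p (unfold A) (closed A∈) k< (μ-rank A (All.lookup formulas A∈) ¬t r<))
        (⊩-elim (∈universe (closed A∈) n≤) d (λ _ → refl , refl))

    Clause⇒⊩ k r p (var x) A∈ ¬t k< r< F = proj₂ (valuation⇒Valid p F)
    Clause⇒⊩ k r (G , zero , n≤) (• A) A∈ ¬t k< r< F =
      step (∈universe A∈ n≤) (inj₂ (inj₂ (inj₂ (inj₁ refl))))
    Clause⇒⊩ (suc k) r (G , suc n , n≤) (• A) A∈ ¬t (s≤s k≤) r< F =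
      ⊩-cut₁ (proj₂ (truth k (suc (rank A)) q A (closed A∈) k≤ ℕₚ.≤-refl) (F q (id , ℕₚ.≤-refl)))
        (step (∈universe A∈ n≤) (inj₂ (inj₂ (inj₂ (inj₂ (here refl))))))
      where q = G , n , ℕₚ.<⇒≤ n≤
    Clause⇒⊩ k (suc r) (G , n , n≤) (A ⇒ B) A∈ ¬t k< r< F = each n ℕₚ.≤-refl
      where
      body : ∀ m → m ≤ n → (A , m) ∷ G ⊩ B at m
      body m l = proj₂ (truth k r q B (proj₂ (closed A∈)) m<k (⇒-rankʳ A B ¬t r<))
        (F q (there , l) (proj₁ (truth k r q A (proj₁ (closed A∈)) m<k (⇒-rankˡ A B ¬t r<)) (hyp (here refl))))
        where
        q = (A , m) ∷ G , m , ℕₚ.≤-trans l n≤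
        m<k = ℕₚ.≤-trans (s≤s l) k<
      -- R may lower the level, so the clause gives the body at every `m ≤ n`; `⇒I` climbs from
      -- level 0, using the implication just below for `Below`.
      each : ∀ m → m ≤ n → G ⊩ A ⇒ B at m
      each zero    l = ⇒I (∈universe A∈ z≤n) (inj₁ refl) (body 0 l)
      each (suc m) l = ⊩-cut₁ (each m (ℕₚ.<⇒≤ l))
        (⇒I (∈universe A∈ (ℕₚ.≤-trans l n≤)) (inj₂ (here refl))
          (⊩-weaken (λ { (here e) → here e ; (there x) → there (there x) }) (body (suc m) l)))
    Clause⇒⊩ k (suc r) p@(_ , _ , n≤) (μ A) A∈ ¬t k< r< F =
      ⊩-cut₁ (proj₂ (truth k r p (unfold A) (closed A∈) k< (μ-rank A (All.lookup formulas A∈) ¬t r<)) F)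
        (step (∈universe A∈ n≤) (inj₂ (inj₂ (inj₂ (here refl)))))

    Fo⇔⊩ : ∀ p {A} → A ∈ Cl → (proj₁ p ⊩ A at level p → Fo p A) × (Fo p A → proj₁ p ⊩ A at level p)
    Fo⇔⊩ p A∈ = truth _ _ p _ A∈ ℕₚ.≤-refl ℕₚ.≤-refl

  countermodel : ∀ {Γ B} → All (_∈ Cl) Γ → B ∈ Cl → ¬ (Γ ⊢ B) →
    Σ LAFrame λ 𝓕 → Σ (Valuation 𝓕) λ ξ → Hereditary 𝓕 ξ × Σ (W 𝓕) λ p₀ →
    Σ (W 𝓕 → PType → Set) (IsForcing 𝓕 ξ) ×
    (∀ Fo → IsForcing 𝓕 ξ Fo → All (Fo p₀) Γ × ¬ Fo p₀ B)
  countermodel {Γ} Γ⊆ B∈ ⊬B = frame , valuation , hereditary , p₀ , (Forced , isForcing) ,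
    λ Fo forcing →
      All.tabulate (λ A∈ → proj₁ (Truth.Fo⇔⊩ forcing p₀ (All.lookup Γ⊆ A∈)) (hyp (∈-map⁺ (_, N) A∈))) ,
      λ F → ⊬B (⊩⇒⊢ (All.map (All.lookup formulas) Γ⊆) (proj₂ (Truth.Fo⇔⊩ forcing p₀ B∈) F))
    where
    p₀ : World
    p₀ = at-N Γ , N , ℕₚ.≤-refl

-- Implication over a list, so that the closure of a single formula suffices.
_⇛_ : Ctx → PType → PType
[]      ⇛ B = B
(A ∷ Γ) ⇛ B = A ⇒ (Γ ⇛ B)

⇛-IsFormula : ∀ {Γ B} → All IsFormula Γ → IsFormula B → IsFormula (Γ ⇛ B)
⇛-IsFormula []      f = f
⇛-IsFormula (a ∷ g) f = a , ⇛-IsFormula g f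

⇛-parts : ∀ {L} Γ {B} → (∀ {C} → C ∈ L → Closed L C) → Γ ⇛ B ∈ L → All (_∈ L) Γ × B ∈ L
⇛-parts []      closed m = [] , m
⇛-parts (A ∷ Γ) closed m with closed m
... | A∈ , rest with ⇛-parts Γ closed rest
...   | Γ⊆ , B∈ = A∈ ∷ Γ⊆ , B∈

theorem10p16 : (As : List PType) (B : PType) → All IsFormula As → IsFormula B →
    ¬ (As ⊢ B) →
    Σ LAFrame λ 𝓕 → Σ (Valuation 𝓕) λ ξ → Hereditary 𝓕 ξ × Σ (W 𝓕) λ p₀ →
    Σ (W 𝓕 → PType → Set) (IsForcing 𝓕 ξ) ×
    (∀ Fo → IsForcing 𝓕 ξ Fo → All (Fo p₀) As × ¬ Fo p₀ B)
theorem10p16 As B fAs fB ⊬B = Countermodel.countermodel Cl formulas closed (proj₁ parts) (proj₂ parts) ⊬B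
  where
  Cl : List PType
  Cl = closure var (As ⇛ B)
  formulas : All IsFormula Cl
  formulas = closure-IsFormula var (As ⇛ B) (λ _ → tt) (⇛-IsFormula fAs fB)
  closed : ∀ {C} → C ∈ Cl → Closed Cl C
  closed = closure-closed var (As ⇛ B) (λ _ → tt) id
  parts : All (_∈ Cl) As × B ∈ Cl
  parts = ⇛-parts As closed (subst (_∈ Cl) (sub-id (λ _ → refl) (As ⇛ B)) (sub∈closure var (As ⇛ B)))
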